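{- The parameterized problems \textsc{Cluster Editing}[cvd] and \textsc{Cluster Editing}[ce] do not admit a boundaried kernelization (of any computable size $f$).
   Context: A boundaried graph $G_B$ is a finite simple graph $G$ together with a set $B\subseteq V(G)$ (the boundary). For boundaried graphs $G_B$ and $H_C$ with $V(G)\cap V(H)\subseteq B\cap C$, the gluing $G_B\oplus H_C$ is the simple graph obtained from the disjoint union of $G$ and $H$ by identifying each vertex of $B\cap C$ in $G$ with the identically named vertex in $H$ (an edge present in both is kept once). For an isomorphism-invariant optimization problem $\Pi$ on graphs with optimum value $\mathrm{OPT}_\Pi(G)$, two $B$-boundaried graphs $G_B,G'_B$ are gluing equivalent w.r.t. $\Pi$ and $B$, written $G_B\equiv_{\Pi,B}G'_B$, if there is $\Delta\in\mathbb{Z}$ with $\mathrm{OPT}_\Pi(G_B\oplus H_B)=\mathrm{OPT}_\Pi(G'_B\oplus H_B)+\Delta$ for every boundaried graph $H_B$. For a pure graph minimization problem $\rho$, a $\rho$-solution of $G$ is a feasible solution $s$ with value $\rho(G,s)$. For computable $f$, a boundaried kernelization of size $f$ for $\Pi[\rho]$ is a polynomial-time algorithm that, given a boundaried graph $G_B$ and a $\rho$-solution $s$ of $G$, outputs a boundaried graph $G'_B$ with $G_B\equiv_{\Pi,B}G'_B$, a $\rho$-solution $s'$ of $G'$ with $|G'|,|s'|,\rho(G',s')\le f(|B|+\rho(G,s))$ (encoding sizes), and an integer $\Delta$ with $\mathrm{OPT}_\Pi(G_B\oplus H_B)=\mathrm{OPT}_\Pi(G'_B\oplus H_B)+\Delta$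 for all $H_B$. A cluster graph is a disjoint union of cliques. \textsc{Cluster Editing} (ce) is the minimization problem whose feasible solutions on $G$ are sets $E$ of vertex pairs such that the graph with edge set $E(G)\triangle E$ is a cluster graph, with value $|E|$. \textsc{Cluster Vertex Deletion} (cvd) is the minimization problem whose feasible solutions are $S\subseteq V(G)$ with $G-S$ a cluster graph, value $|S|$. $\Pi$[cvd], $\Pi$[ce] denote $\rho=$ cvd, resp. $\rho=$ ce, with $\Pi=$ \textsc{Cluster Editing}. -}

module Defs where

open import Data.Bool.Base using (Bool; true; false; _∧_; _∨_; not; _xor_)
open import Data.Bool.Properties using (∧-comm; ∨-comm)
open import Data.Empty using (⊥-elim)
open import Data.Fin.Base using (Fin)
open import Data.Integer.Base as ℤ using (ℤ; +_; -[1+_])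
open import Data.List.Base using (List; []; _∷_; _++_; length; map; concatMap; filter; deduplicate)
open import Data.List.Membership.DecPropositional using () renaming (_∈?_ to member?)
open import Data.List.Membership.Propositional using (_∈_; _∉_)
open import Data.List.Membership.Propositional.Properties
  using (∈-++⁺ˡ; ∈-++⁺ʳ; ∈-deduplicate⁺; ∈-filter⁺)
open import Data.List.Relation.Unary.All as All using (All)
open import Data.List.Relation.Unary.Unique.DecPropositional.Properties using (deduplicate-!)
open import Data.List.Relation.Unary.Unique.Propositional using (Unique)
open import Data.List.Relation.Unary.Unique.Propositional.Properties using (filter⁺)
open import Data.Maybe.Base using (Maybe; just; nothing)
open import Data.Nat.Base using (ℕ; zero; suc; _+_; _*_; _^_; _≤_; _<_)
open import Data.Nat.Binary.Base as ℕᵇ using (ℕᵇ; 2[1+_]; 1+[2_])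
open import Data.Nat.Properties using (_≟_; <-irrefl)
open import Data.Product.Base using (Σ; ∃-syntax; Σ-syntax; _×_; _,_; proj₁; proj₂)
open import Data.Product.Properties using (≡-dec)
open import Function.Bundles using (_⇔_)
open import Relation.Binary.Definitions using (DecidableEquality)
open import Relation.Binary.PropositionalEquality
  using (_≡_; _≢_; refl; cong; cong₂)
open import Relation.Nullary.Decidable.Core using (Dec; yes; no; does; ¬?)

------------------------------------------------------------------------
-- Finite sets of vertices (vertices are named by natural numbers)

infix 4 _∈?_

_∈?_ : (v : ℕ) (xs : List ℕ) → Dec (v ∈ xs)
_∈?_ = member? _≟_

record FinSet : Set where
  field
    elems  : List ℕ
    unique : Unique elems

open FinSet public

infix 4 _∈ₛ_ _⊆ₛ_
infixl 6 _∪ₛ_ _∖ₛ_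

_∈ₛ_ : ℕ → FinSet → Set
v ∈ₛ S = v ∈ elems S

_⊆ₛ_ : FinSet → FinSet → Set
S ⊆ₛ T = ∀ {v} → v ∈ₛ S → v ∈ₛ T

∣_∣ₛ : FinSet → ℕ
∣ S ∣ₛ = length (elems S)

mem : FinSet → ℕ → Bool
mem S v = does (v ∈? elems S)

_∪ₛ_ : FinSet → FinSet → FinSet
S ∪ₛ T = record
  { elems  = deduplicate _≟_ (elems S ++ elems T)
  ; unique = deduplicate-! _≟_ (elems S ++ elems T)
  }

_∖ₛ_ : FinSet → FinSet → FinSet
S ∖ₛ T = record
  { elems  = filter (λ v → ¬? (v ∈? elems T)) (elems S)
  ; unique = filter⁺ (λ v → ¬? (v ∈? elems T)) (unique S)
  }

------------------------------------------------------------------------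
-- Finite simple graphs

record Graph : Set where
  field
    V          : FinSet
    adj        : ℕ → ℕ → Bool
    adj-sym    : ∀ u v → adj u v ≡ adj v u
    adj-irrefl : ∀ v → adj v v ≡ false
    adj-inV    : ∀ u v → adj u v ≡ true → u ∈ₛ V

open Graph public

Adj : Graph → ℕ → ℕ → Set
Adj G u v = adj G u v ≡ true

-- A cluster graph is a disjoint union of cliques; clique v is the index
-- of the clique containing v.
IsClusterGraph : Graph → Set
IsClusterGraph G =
  Σ[ clique ∈ (ℕ → ℕ) ]
    (∀ u v → u ∈ₛ V G → v ∈ₛ V G → (Adj G u v ⇔ (u ≢ v × clique u ≡ clique v)))

------------------------------------------------------------------------
-- Boundaried graphs and gluing

record BoundariedGraph (B : FinSet) : Set where
  field
    graph       : Graph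
    boundary⊆V  : B ⊆ₛ V graph

open BoundariedGraph public

Gluable : ∀ {B C} → BoundariedGraph B → BoundariedGraph C → Set
Gluable {B} {C} G H =
  ∀ {v} → v ∈ₛ V (graph G) → v ∈ₛ V (graph H) → v ∈ₛ B × v ∈ₛ C

private
  ∨-split : ∀ x y {P : Set} → (x ≡ true → P) → (y ≡ true → P) → x ∨ y ≡ true → P
  ∨-split true  y f g _ = f refl
  ∨-split false y f g p = g p

  ∧-fst : ∀ x y → x ∧ y ≡ true → x ≡ true
  ∧-fst true y _ = refl

  ∧-snd : ∀ x y → x ∧ y ≡ true → y ≡ true
  ∧-snd true y p = p

-- As the only names shared by G and H are those in B ∩ C, the disjoint
-- union with the vertices of B ∩ C identified is the union by name.
glue : ∀ {B C} (G : BoundariedGraph B) (H : BoundariedGraph C) → Gluable G H → Graph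
glue G H _ = record
  { V          = V (graph G) ∪ₛ V (graph H)
  ; adj        = λ u v → adj (graph G) u v ∨ adj (graph H) u v
  ; adj-sym    = λ u v → cong₂ _∨_ (adj-sym (graph G) u v) (adj-sym (graph H) u v)
  ; adj-irrefl = λ v → cong₂ _∨_ (adj-irrefl (graph G) v) (adj-irrefl (graph H) v)
  ; adj-inV    = λ u v → ∨-split (adj (graph G) u v) (adj (graph H) u v)
      (λ p → ∈-deduplicate⁺ _≟_ (∈-++⁺ˡ (adj-inV (graph G) u v p)))
      (λ p → ∈-deduplicate⁺ _≟_
               (∈-++⁺ʳ (elems (V (graph G))) (adj-inV (graph H) u v p)))
  }

syntax glue G H p = G ⊕ H [ p ]

------------------------------------------------------------------------
-- Binary words and encodings

Word : Set
Word = List Bool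

-- Self-delimiting, of length O(log n).
encodeℕᵇ : ℕᵇ → Word
encodeℕᵇ ℕᵇ.zero  = false ∷ []
encodeℕᵇ 2[1+ x ] = true ∷ false ∷ encodeℕᵇ x
encodeℕᵇ 1+[2 x ] = true ∷ true ∷ encodeℕᵇ x

encodeℕ : ℕ → Word
encodeℕ n = encodeℕᵇ (ℕᵇ.fromℕ n)

encodeℤ : ℤ → Word
encodeℤ (+ n)    = false ∷ encodeℕ n
encodeℤ -[1+ n ] = true ∷ encodeℕ n

-- Characteristic vector of a set of vertices, respectively 0/1-matrix of
-- a relation on vertices, in the order in which V is listed.
vectorOver : FinSet → (ℕ → Bool) → Word
vectorOver V p = map p (elems V)

matrixOver : FinSet → (ℕ → ℕ → Bool) → Word
matrixOver V r = concatMap (λ u → map (r u) (elems V)) (elems V)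

-- The number of vertices and the adjacency matrix; vertex names omitted.
encodeGraph : Graph → Word
encodeGraph G = encodeℕ ∣ V G ∣ₛ ++ matrixOver (V G) (adj G)

-- The size does not charge for vertex names: an output graph has to keep
-- the names of its boundary, and these can be arbitrarily large numbers
-- even when there are few of them.
graphSize : Graph → ℕ
graphSize G = length (encodeGraph G)

-- What an algorithm reads and writes does include the names.
encodeBoundaried : ∀ {B} → BoundariedGraph B → Word
encodeBoundaried {B} G =
  encodeGraph (graph G)
  ++ concatMap encodeℕ (elems (V (graph G)))
  ++ vectorOver (V (graph G)) (mem B)

------------------------------------------------------------------------
-- Graph minimization problems

record MinimizationProblem : Set₁ where
  field
    Candidate : Graph → Set
    Feasible  : (G : Graph) → Candidate G → Set
    value     : (G : Graph) → Candidate G → ℕ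
    encode    : (G : Graph) → Candidate G → Word

  Solution : Graph → Set
  Solution G = Σ (Candidate G) (Feasible G)

  solutionValue : (G : Graph) → Solution G → ℕ
  solutionValue G (s , _) = value G s

  encodeSolution : (G : Graph) → Solution G → Word
  encodeSolution G (s , _) = encode G s

  solutionSize : (G : Graph) → Solution G → ℕ
  solutionSize G s = length (encodeSolution G s)

  -- OPT(G) = k
  IsOPT : Graph → ℕ → Set
  IsOPT G k = (Σ[ s ∈ Solution G ] solutionValue G s ≡ k)
            × (∀ (s : Solution G) → k ≤ solutionValue G s)

open MinimizationProblem public using (IsOPT)

------------------------------------------------------------------------
-- Cluster Editing

-- A set of unordered pairs of distinct vertices; {u , v} is represented
-- by the ordered pair (u , v) with u < v.
record PairSet (X : FinSet) : Set where
  field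
    pairs  : List (ℕ × ℕ)
    unique : Unique pairs
    valid  : All (λ p → proj₁ p < proj₂ p × proj₁ p ∈ₛ X × proj₂ p ∈ₛ X) pairs

open PairSet public using (pairs; valid)

_≟ₚ_ : DecidableEquality (ℕ × ℕ)
_≟ₚ_ = ≡-dec _≟_ _≟_

pairIn : ∀ {X} → PairSet X → ℕ → ℕ → Bool
pairIn E u v = does (member? _≟ₚ_ (u , v) (pairs E)) ∨ does (member? _≟ₚ_ (v , u) (pairs E))

private
  pairIn-irrefl : ∀ {X} (E : PairSet X) v → pairIn E v v ≡ false
  pairIn-irrefl E v with member? _≟ₚ_ (v , v) (pairs E)
  ... | yes p = ⊥-elim (<-irrefl refl (proj₁ (All.lookup (valid E) p)))
  ... | no  _ = refl

  pairIn-inX : ∀ {X} (E : PairSet X) u v → pairIn E u v ≡ true → u ∈ₛ X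
  pairIn-inX E u v eq with member? _≟ₚ_ (u , v) (pairs E)
  ... | yes p = proj₁ (proj₂ (All.lookup (valid E) p))
  ... | no  _ with member? _≟ₚ_ (v , u) (pairs E)
  ...   | yes q = proj₂ (proj₂ (All.lookup (valid E) q))
  pairIn-inX E u v () | no _ | no _

  xor-split : ∀ x y {P : Set} → (x ≡ true → P) → (y ≡ true → P) → x xor y ≡ true → P
  xor-split true  y f g _ = f refl
  xor-split false y f g p = g p

infixl 6 _△_ _─_

-- The graph on V(G) with edge set E(G) △ E.
_△_ : (G : Graph) → PairSet (V G) → Graph
G △ E = record
  { V          = V G
  ; adj        = λ u v → adj G u v xor pairIn E u v
  ; adj-sym    = λ u v → cong₂ _xor_ (adj-sym G u v)
      (∨-comm (does (member? _≟ₚ_ (u , v) (pairs E))) (does (member? _≟ₚ_ (v , u) (pairs E))))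
  ; adj-irrefl = λ v → cong₂ _xor_ (adj-irrefl G v) (pairIn-irrefl E v)
  ; adj-inV    = λ u v → xor-split (adj G u v) (pairIn E u v)
                           (adj-inV G u v) (pairIn-inX E u v)
  }

ClusterEditing : MinimizationProblem
ClusterEditing = record
  { Candidate = λ G → PairSet (V G)
  ; Feasible  = λ G E → IsClusterGraph (G △ E)
  ; value     = λ G E → length (pairs E)
  ; encode    = λ G E → matrixOver (V G) (pairIn E)
  }

------------------------------------------------------------------------
-- Cluster Vertex Deletion

private
  not-mem : ∀ S v → not (mem S v) ≡ true → v ∉ elems S
  not-mem S v eq with v ∈? elems S
  not-mem S v () | yes _
  ... | no  v∉S = v∉S

-- The graph G − S.
_─_ : Graph → FinSet → Graph
G ─ S = record
  { V          = V G ∖ₛ S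
  ; adj        = λ u v → adj G u v ∧ (not (mem S u) ∧ not (mem S v))
  ; adj-sym    = λ u v → cong₂ _∧_ (adj-sym G u v) (∧-comm (not (mem S u)) (not (mem S v)))
  ; adj-irrefl = λ v → cong (_∧ (not (mem S v) ∧ not (mem S v))) (adj-irrefl G v)
  ; adj-inV    = λ u v p → ∈-filter⁺ (λ w → ¬? (w ∈? elems S))
      (adj-inV G u v (∧-fst (adj G u v) _ p))
      (not-mem S u (∧-fst (not (mem S u)) (not (mem S v)) (∧-snd (adj G u v) _ p)))
  }

ClusterVertexDeletion : MinimizationProblem
ClusterVertexDeletion = record
  { Candidate = λ G → Σ[ S ∈ FinSet ] (S ⊆ₛ V G)
  ; Feasible  = λ G (S , _) → IsClusterGraph (G ─ S)
  ; value     = λ G (S , _) → ∣ S ∣ₛ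
  ; encode    = λ G (S , _) → vectorOver (V G) (mem S)
  }

------------------------------------------------------------------------
-- Gluing equivalence

-- OPT(G ⊕ H) = OPT(G′ ⊕ H) + Δ for every H with the same boundary.  Both
-- gluings have to be defined, so the non-boundary vertices of H range
-- over names used neither in G nor in G′.
GluingShift : MinimizationProblem → ∀ {B} → BoundariedGraph B → BoundariedGraph B → ℤ → Set
GluingShift Π {B} G G′ Δ =
  ∀ (H : BoundariedGraph B) (p : Gluable G H) (p′ : Gluable G′ H) →
  ∃[ k ] ∃[ k′ ] IsOPT Π (G ⊕ H [ p ]) k × IsOPT Π (G′ ⊕ H [ p′ ]) k′ × + k ≡ + k′ ℤ.+ Δ

GluingEquivalent : MinimizationProblem → ∀ {B} → BoundariedGraph B → BoundariedGraph B → Set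
GluingEquivalent Π G G′ = ∃[ Δ ] GluingShift Π G G′ Δ

------------------------------------------------------------------------
-- Deterministic single-tape Turing machines

data Symbol (k : ℕ) : Set where
  blank : Symbol k
  bit   : Bool → Symbol k
  aux   : Fin k → Symbol k

data Move : Set where
  left stay right : Move

record TuringMachine : Set where
  field
    states     : ℕ
    auxSymbols : ℕ
    start      : Fin states
    -- nothing means that the machine halts
    transition : Fin states → Symbol auxSymbols →
                 Maybe (Fin states × Symbol auxSymbols × Move)

-- The two-way infinite tape  … l₁ l₀ h r₀ r₁ …  with the head on h, where
-- cells beyond the ends of both lists are blank.
record Tape (k : ℕ) : Set where
  constructor tape
  field
    lefts  : List (Symbol k)
    head   : Symbol k
    rights : List (Symbol k)

uncons : ∀ {k} → List (Symbol k) → Symbol k × List (Symbol k)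
uncons []       = blank , []
uncons (x ∷ xs) = x , xs

move : ∀ {k} → Move → Tape k → Tape k
move left  (tape ls h rs) = tape (proj₂ (uncons ls)) (proj₁ (uncons ls)) (h ∷ rs)
move stay  t              = t
move right (tape ls h rs) = tape (h ∷ ls) (proj₁ (uncons rs)) (proj₂ (uncons rs))

write : ∀ {k} → Symbol k → Tape k → Tape k
write s (tape ls _ rs) = tape ls s rs

initialTape : ∀ {k} → Word → Tape k
initialTape w = tape [] (proj₁ (uncons (map bit w))) (proj₂ (uncons (map bit w)))

leadingBits : ∀ {k} → List (Symbol k) → Word
leadingBits (bit b ∷ xs) = b ∷ leadingBits xs
leadingBits (blank ∷ _)  = []
leadingBits (aux _ ∷ _)  = []
leadingBits []           = []

-- The output is the maximal word of bits starting at the head.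
readOutput : ∀ {k} → Tape k → Word
readOutput (tape _ h rs) = leadingBits (h ∷ rs)

module _ (M : TuringMachine) where
  open TuringMachine M

  -- The output if the machine halts after at most the given number of steps.
  runFor : ℕ → Fin states → Tape auxSymbols → Maybe Word
  runFor t q τ with transition q (Tape.head τ)
  runFor t       q τ | nothing            = just (readOutput τ)
  runFor zero    q τ | just _             = nothing
  runFor (suc t) q τ | just (q′ , s , m)  = runFor t q′ (move m (write s τ))

  OutputsWithin : ℕ → Word → Word → Set
  OutputsWithin t w w′ = runFor t start (initialTape w) ≡ just w′

Computable : (ℕ → ℕ) → Set
Computable f = Σ[ M ∈ TuringMachine ]
  (∀ n → ∃[ t ] OutputsWithin M t (encodeℕ n) (encodeℕ (f n)))

------------------------------------------------------------------------
-- Boundaried kernelization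

-- A possible result of a boundaried kernelization of size f for Π[ρ] on
-- the boundaried graph G and the ρ-solution s.
record Kernel (Π ρ : MinimizationProblem) (f : ℕ → ℕ) {B : FinSet}
              (G : BoundariedGraph B) (s : MinimizationProblem.Solution ρ (graph G)) : Set where
  open MinimizationProblem ρ

  parameter : ℕ
  parameter = ∣ B ∣ₛ + solutionValue (graph G) s

  field
    G′ : BoundariedGraph B
    s′ : Solution (graph G′)
    Δ  : ℤ
    equivalent    : GluingEquivalent Π G G′
    shift         : GluingShift Π G G′ Δ
    graph-size    : graphSize (graph G′) ≤ f parameter
    solution-size : solutionSize (graph G′) s′ ≤ f parameter
    value-bound   : solutionValue (graph G′) s′ ≤ f parameter

  encodeKernel : Word
  encodeKernel = encodeBoundaried G′ ++ encodeSolution (graph G′) s′ ++ encodeℤ Δ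

encodeInput : (ρ : MinimizationProblem) → ∀ {B} (G : BoundariedGraph B) →
              MinimizationProblem.Solution ρ (graph G) → Word
encodeInput ρ G s = encodeBoundaried G ++ MinimizationProblem.encodeSolution ρ (graph G) s

-- On inputs of length n the machine takes at most c · n ^ d + c steps.
record BoundariedKernelization (Π ρ : MinimizationProblem) (f : ℕ → ℕ) : Set where
  field
    machine : TuringMachine
    c d     : ℕ
    correct : ∀ {B} (G : BoundariedGraph B) (s : MinimizationProblem.Solution ρ (graph G)) →
      Σ[ K ∈ Kernel Π ρ f G s ]
        OutputsWithin machine (c * length (encodeInput ρ G s) ^ d + c)
          (encodeInput ρ G s) (Kernel.encodeKernel K)

AdmitsBoundariedKernelization : (Π ρ : MinimizationProblem) → Set
AdmitsBoundariedKernelization Π ρ =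
  ∃[ f ] Computable f × BoundariedKernelization Π ρ f

{-# OPTIONS --safe #-}
-- Let G be a clique on N + 2 vertices, where N = f 1, with one boundary vertex:
-- its parameter is 1 for both cvd and ce.  Gluing the single boundary vertex to
-- G costs nothing, whereas gluing a second clique on N + 2 vertices creates
-- N + 1 edge-disjoint induced paths on three vertices, so the optimum grows by
-- at least N + 1.  For a kernel G′ it can grow by at most N, since deleting all
-- edges of G′ takes at most |V(G′)|² ≤ graphSize G′ ≤ N edits.
module Submission where

open import Defs
open import Data.Bool.Base using (Bool; true; false; _∨_; _xor_; if_then_else_)
open import Data.Bool.Properties
  using (⇔→≡; ∧-identityʳ; xor-identityʳ) renaming (_≟_ to _≟ᵇ_)
open import Data.Fin.Base using (Fin; toℕ)
open import Data.Fin.Properties using (injective⇒≤; toℕ-injective; toℕ<n)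
open import Data.Integer.Base as ℤ using (+_)
import Data.Integer.Properties as ℤ
open import Data.Integer.Tactic.RingSolver using (solve-∀)
open import Data.List.Base
  using (List; []; _∷_; length; map; concatMap; filter; applyUpTo; cartesianProduct; lookup)
open import Data.List.Extrema.Nat using (max; xs≤max)
open import Data.List.Membership.DecPropositional using () renaming (_∈?_ to member?)
open import Data.List.Membership.Propositional using (_∈_)
open import Data.List.Membership.Propositional.Properties
  using (∈-applyUpTo⁺; ∈-applyUpTo⁻; ∈-cartesianProduct⁺; ∈-cartesianProduct⁻;
         ∈-filter⁺; ∈-filter⁻; ∈-++⁺ˡ; ∈-deduplicate⁺)
open import Data.List.Properties using (length-++; length-map; length-filter)
open import Data.List.Relation.Unary.All as All using (All)
open import Data.List.Relation.Unary.All.Properties using () renaming (applyUpTo⁺₂ to All-applyUpTo)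
open import Data.List.Relation.Unary.AllPairs using ([]; _∷_)
open import Data.List.Relation.Unary.Any using (here; there; index)
open import Data.List.Relation.Unary.Any.Properties using (lookup-index)
open import Data.List.Relation.Unary.Unique.Propositional.Properties
  using (applyUpTo⁺₁; cartesianProduct⁺) renaming (filter⁺ to Unique-filter)
open import Data.Nat.Base using (ℕ; suc; _+_; _*_; _≤_; _<_; z≤n; s≤s; z<s; s<s)
open import Data.Nat.Properties
open import Data.Product.Base using (∃-syntax; Σ-syntax; _×_; _,_; proj₁; proj₂)
open import Data.Sum.Base using (_⊎_; inj₁; inj₂; [_,_]′)
open import Function.Base using (_∘_)
open import Function.Bundles using (mk⇔; Equivalence)
open import Function.Definitions using (Injective)
open import Relation.Binary.Definitions using (tri<; tri≈; tri>)
open import Relation.Binary.PropositionalEquality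
open import Relation.Nullary.Decidable using (Dec; yes; no; does; dec-true; dec-false; _×-dec_; ¬?)
open import Relation.Nullary.Negation using (¬_; contradiction)

open MinimizationProblem using (Solution; solutionValue)
open Equivalence using (to; from)

does-true⁻ : ∀ {p} {P : Set p} (P? : Dec P) → does P? ≡ true → P
does-true⁻ (yes p) _ = p

-- Complete graphs

complete : FinSet → Graph
complete S = record
  { V          = S
  ; adj        = λ u v → does (edge? u v)
  ; adj-sym    = λ u v → ⇔→≡ (mk⇔ (swapped u v) (swapped v u))
  ; adj-irrefl = λ v → dec-false (edge? v v) λ (_ , _ , v≢v) → v≢v refl
  ; adj-inV    = λ u v → proj₁ ∘ does-true⁻ (edge? u v)
  }
  where
  edge? : ∀ u v → Dec (u ∈ₛ S × v ∈ₛ S × u ≢ v)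
  edge? u v = (u ∈? elems S) ×-dec (v ∈? elems S) ×-dec ¬? (u ≟ v)

  swapped : ∀ u v → does (edge? u v) ≡ true → does (edge? v u) ≡ true
  swapped u v uv with u∈S , v∈S , u≢v ← does-true⁻ (edge? u v) uv =
    dec-true (edge? v u) (v∈S , u∈S , u≢v ∘ sym)

module _ (S : FinSet) where

  adj-complete⁺ : ∀ {u v} → u ∈ₛ S → v ∈ₛ S → u ≢ v → Adj (complete S) u v
  adj-complete⁺ {u} {v} u∈S v∈S u≢v =
    dec-true ((u ∈? elems S) ×-dec (v ∈? elems S) ×-dec ¬? (u ≟ v)) (u∈S , v∈S , u≢v)

  adj-complete⁻ : ∀ {u v} → Adj (complete S) u v → u ∈ₛ S × v ∈ₛ S × u ≢ v
  adj-complete⁻ {u} {v} =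
    does-true⁻ ((u ∈? elems S) ×-dec (v ∈? elems S) ×-dec ¬? (u ≟ v))

  -- Vertices outside S are isolated, whence the singleton indices suc v.
  isCluster-complete : ∀ X → (∀ u v → adj X u v ≡ adj (complete S) u v) → IsClusterGraph X
  isCluster-complete X X≡S = clique , λ u v _ _ → mk⇔ (⇒ u v) (λ (u≢v , eq) → ⇐ u v u≢v eq)
    where
    clique : ℕ → ℕ
    clique v = if mem S v then 0 else suc v

    clique-∈ : ∀ {v} → v ∈ₛ S → clique v ≡ 0
    clique-∈ {v} v∈S rewrite dec-true (v ∈? elems S) v∈S = refl

    ⇒ : ∀ u v → Adj X u v → u ≢ v × clique u ≡ clique v
    ⇒ u v uv with u∈S , v∈S , u≢v ← adj-complete⁻ (trans (sym (X≡S u v)) uv) =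
      u≢v , trans (clique-∈ u∈S) (sym (clique-∈ v∈S))

    ⇐ : ∀ u v → u ≢ v → clique u ≡ clique v → Adj X u v
    ⇐ u v u≢v eq with u ∈? elems S | v ∈? elems S
    ... | yes u∈S | yes v∈S = trans (X≡S u v) (adj-complete⁺ u∈S v∈S u≢v)
    ... | no _    | no _    = contradiction (suc-injective eq) u≢v
    ⇐ u v u≢v () | yes _ | no _
    ⇐ u v u≢v () | no _  | yes _

∅ : FinSet
∅ = record { elems = [] ; unique = [] }

∅ₚ : ∀ {X} → PairSet X
∅ₚ = record { pairs = [] ; unique = [] ; valid = All.[] }

-- Cliques are already cluster graphs, so the empty solution keeps the parameter of an input clique
-- down to the size of its boundary, however large the clique is.
complete-ce : ∀ S → Σ[ s ∈ Solution ClusterEditing (complete S) ]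
              solutionValue ClusterEditing (complete S) s ≡ 0
complete-ce S = (∅ₚ , isCluster-complete S (complete S △ ∅ₚ) λ u v → xor-identityʳ _) , refl

complete-cvd : ∀ S → Σ[ s ∈ Solution ClusterVertexDeletion (complete S) ]
               solutionValue ClusterVertexDeletion (complete S) s ≡ 0
complete-cvd S = ((∅ , λ ()) , isCluster-complete S (complete S ─ ∅) λ u v → ∧-identityʳ _) , refl

-- Bounds on the cluster editing optimum

pairIn⁻ : ∀ {X} (E : PairSet X) {u v} → u < v → pairIn E u v ≡ true → (u , v) ∈ pairs E
pairIn⁻ E {u} {v} u<v eq with member? _≟ₚ_ (u , v) (pairs E)
... | yes uv = uv
... | no _ with member? _≟ₚ_ (v , u) (pairs E)
...   | yes vu = contradiction u<v (<-asym (proj₁ (All.lookup (valid E) vu)))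
pairIn⁻ E u<v () | no _ | no _

-- Every path aᵢ – b – cᵢ contains an edited pair.  As b is the least vertex, the
-- larger end of this pair is aᵢ or cᵢ and therefore determines i.
paths≤solutionValue :
  ∀ {m} (G : Graph) {b} (a c : Fin m → ℕ) →
  (∀ i → b < a i) → (∀ i → a i < c i) →
  Injective _≡_ _≡_ a → Injective _≡_ _≡_ c → (∀ i j → a i ≢ c j) →
  (∀ i → Adj G b (a i)) → (∀ i → Adj G b (c i)) → (∀ i → ¬ Adj G (a i) (c i)) →
  ∀ s → m ≤ solutionValue ClusterEditing G s
paths≤solutionValue G {b} a c b<a a<c a-inj c-inj a≢c ba bc ¬ac (E , clique , cluster) =
  -- Pigeonhole: sending `i` to the position of its edited pair in `pairs E` is an injection from
  -- `Fin m` into the positions of that list.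
  injective⇒≤ {f = λ i → index (edited∈ i)} λ {i} {j} eq →
    unique-end i j (edited-end i) (subst (Ends j ∘ proj₂) (sym (edited-≡ i j eq)) (edited-end j))
  where
  Ends : Fin _ → ℕ → Set
  Ends i v = v ≡ a i ⊎ v ≡ c i

  unedited : ∀ {u v} → pairIn E u v ≡ false → adj (G △ E) u v ≡ adj G u v
  unedited eq = trans (cong (adj G _ _ xor_) eq) (xor-identityʳ _)

  edited : ∀ i → ∃[ p ] (p ∈ pairs E × Ends i (proj₂ p))
  edited i with pairIn E b (a i) in ba∈E | pairIn E b (c i) in bc∈E | pairIn E (a i) (c i) in ac∈E
  ... | true  | _     | _     = _ , pairIn⁻ E (b<a i) ba∈E , inj₁ refl
  ... | false | true  | _     = _ , pairIn⁻ E (<-trans (b<a i) (a<c i)) bc∈E , inj₂ refl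
  ... | false | false | true  = _ , pairIn⁻ E (a<c i) ac∈E , inj₂ refl
  -- With no pair edited, `b` still sees both ends, so `a i` and `c i` lie in one clique of `G △ E`.
  -- Their edge would then already be present in `G`.
  ... | false | false | false = contradiction
    (trans (sym (unedited ac∈E)) (from (cluster _ _ a∈V c∈V) (<⇒≢ (a<c i) , trans (sym b~a) b~c)))
    (¬ac i)
    where
    b∈V = adj-inV G b (a i) (ba i)
    a∈V = adj-inV G (a i) b (trans (adj-sym G (a i) b) (ba i))
    c∈V = adj-inV G (c i) b (trans (adj-sym G (c i) b) (bc i))
    b~a = proj₂ (to (cluster _ _ b∈V a∈V) (trans (unedited ba∈E) (ba i)))
    b~c = proj₂ (to (cluster _ _ b∈V c∈V) (trans (unedited bc∈E) (bc i)))

  edited∈ = λ i → proj₁ (proj₂ (edited i))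
  edited-end = λ i → proj₂ (proj₂ (edited i))

  edited-≡ : ∀ i j → index (edited∈ i) ≡ index (edited∈ j) → proj₁ (edited i) ≡ proj₁ (edited j)
  edited-≡ i j eq = trans (lookup-index (edited∈ i))
    (trans (cong (lookup (pairs E)) eq) (sym (lookup-index (edited∈ j))))

  unique-end : ∀ i j {v} → Ends i v → Ends j v → i ≡ j
  unique-end i j (inj₁ v≡a) (inj₁ v≡a′) = a-inj (trans (sym v≡a) v≡a′)
  unique-end i j (inj₁ v≡a) (inj₂ v≡c)  = contradiction (trans (sym v≡a) v≡c) (a≢c i j)
  unique-end i j (inj₂ v≡c) (inj₁ v≡a)  = contradiction (trans (sym v≡a) v≡c) (a≢c j i)
  unique-end i j (inj₂ v≡c) (inj₂ v≡c′) = c-inj (trans (sym v≡c) v≡c′)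

length-cartesianProduct : ∀ {a b} {A : Set a} {B : Set b} (xs : List A) (ys : List B) →
                          length (cartesianProduct xs ys) ≡ length xs * length ys
length-cartesianProduct []       ys = refl
length-cartesianProduct (x ∷ xs) ys =
  trans (length-++ (map (x ,_) ys)) (cong₂ _+_ (length-map _ ys) (length-cartesianProduct xs ys))

length-matrix : ∀ (r : ℕ → ℕ → Bool) us vs →
                length (concatMap (λ u → map (r u) vs) us) ≡ length us * length vs
length-matrix r []       vs = refl
length-matrix r (u ∷ us) vs =
  trans (length-++ (map (r u) vs)) (cong₂ _+_ (length-map _ vs) (length-matrix r us vs))

-- The adjacency matrix alone contributes one bit per ordered pair of vertices.
∣V∣²≤graphSize : ∀ G → ∣ V G ∣ₛ * ∣ V G ∣ₛ ≤ graphSize G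
∣V∣²≤graphSize G = begin
  ∣ V G ∣ₛ * ∣ V G ∣ₛ                                          ≡⟨ length-matrix (adj G) (elems (V G)) (elems (V G)) ⟨
  length (matrixOver (V G) (adj G))                            ≤⟨ m≤n+m _ _ ⟩
  length (encodeℕ ∣ V G ∣ₛ) + length (matrixOver (V G) (adj G)) ≡⟨ length-++ (encodeℕ ∣ V G ∣ₛ) ⟨
  graphSize G                                                  ∎
  where open ≤-Reasoning

-- Disjointness matters: gluing keeps a common edge only once, so deleting the edges of one side
-- would also remove it from the other.
∨-xor-cancelˡ : ∀ x y → ¬ (x ≡ true × y ≡ true) → (x ∨ y) xor x ≡ y
∨-xor-cancelˡ true  true  disjoint = contradiction (refl , refl) disjoint
∨-xor-cancelˡ true  false disjoint = refl
∨-xor-cancelˡ false y     disjoint = xor-identityʳ y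

-- The solution deletes all edges of G.
∃solution≤∣V∣² :
  ∀ {B C} (G : BoundariedGraph B) (H : BoundariedGraph C) (p : Gluable G H) T →
  graph H ≡ complete T → (∀ u v → Adj (graph G) u v → ¬ Adj (graph H) u v) →
  Σ[ s ∈ Solution ClusterEditing (G ⊕ H [ p ]) ]
    solutionValue ClusterEditing (G ⊕ H [ p ]) s ≤ ∣ V (graph G) ∣ₛ * ∣ V (graph G) ∣ₛ
∃solution≤∣V∣² G H p T refl disjoint =
  -- Only the edges of `complete T` survive. The vertices of `G` outside `T` become isolated, which
  -- `isCluster-complete` permits since it compares adjacencies and not vertex sets.
  (E , isCluster-complete T (G ⊕ H [ p ] △ E) λ u v →
    trans (cong ((adj (graph G) u v ∨ adj (graph H) u v) xor_) (pairIn-E u v))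
          (∨-xor-cancelˡ _ _ λ (uv∈G , uv∈H) → disjoint u v uv∈G uv∈H))
  , ≤-trans (length-filter edge? (cartesianProduct VG VG))
            (≤-reflexive (length-cartesianProduct VG VG))
  where
  VG = elems (V (graph G))

  edge? : (e : ℕ × ℕ) → Dec (proj₁ e < proj₂ e × Adj (graph G) (proj₁ e) (proj₂ e))
  edge? (u , v) = (u <? v) ×-dec (adj (graph G) u v ≟ᵇ true)

  glued : ∀ {v} → v ∈ VG → v ∈ₛ V (G ⊕ H [ p ])
  glued v∈G = ∈-deduplicate⁺ _≟_ (∈-++⁺ˡ v∈G)

  E : PairSet (V (G ⊕ H [ p ]))
  E = record
    { pairs  = filter edge? (cartesianProduct VG VG)
    ; unique = Unique-filter edge? (cartesianProduct⁺ (unique (V (graph G))) (unique (V (graph G))))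
    ; valid  = All.tabulate λ e∈E →
        let e∈V² , u<v , _ = ∈-filter⁻ edge? {xs = cartesianProduct VG VG} e∈E
            u∈G , v∈G      = ∈-cartesianProduct⁻ VG VG e∈V²
        in u<v , glued u∈G , glued v∈G
    }

  sym-adj : ∀ u v → Adj (graph G) u v → Adj (graph G) v u
  sym-adj u v uv = trans (adj-sym (graph G) v u) uv

  ∈E⁺ : ∀ {u v} → u < v → Adj (graph G) u v → (u , v) ∈ pairs E
  ∈E⁺ {u} {v} u<v uv = ∈-filter⁺ edge?
    (∈-cartesianProduct⁺ (adj-inV (graph G) u v uv) (adj-inV (graph G) v u (sym-adj u v uv)))
    (u<v , uv)

  ∈E⁻ : ∀ {u v} → (u , v) ∈ pairs E → Adj (graph G) u v
  ∈E⁻ e∈E = proj₂ (proj₂ (∈-filter⁻ edge? {xs = cartesianProduct VG VG} e∈E))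

  pairIn-E : ∀ u v → pairIn E u v ≡ adj (graph G) u v
  pairIn-E u v with member? _≟ₚ_ (u , v) (pairs E) | member? _≟ₚ_ (v , u) (pairs E)
  ... | yes uv | _      = sym (∈E⁻ uv)
  ... | no _   | yes vu = sym (sym-adj v u (∈E⁻ vu))
  -- An edge of `G` would have its increasing orientation listed in `E`, so here `u` and `v` are not
  -- adjacent.
  ... | no ∌uv | no ∌vu with adj (graph G) u v in uv
  ...   | false = refl
  ...   | true with <-cmp u v
  ...     | tri< u<v _ _ = contradiction (∈E⁺ u<v uv) ∌uv
  ...     | tri> _ _ v<u = contradiction (∈E⁺ v<u (sym-adj u v uv)) ∌vu
  ...     | tri≈ _ refl _ with () ← trans (sym uv) (adj-irrefl (graph G) u)

-- Cliques sharing the boundary vertex 0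

-- The offset `k` lifts the `m` names other than 0 above `k`, beyond the names of a graph to be
-- glued, so that only 0 is shared.
clique-set : ℕ → ℕ → FinSet
clique-set k m = record
  { elems  = 0 ∷ applyUpTo (λ i → suc (k + i)) m
  ; unique = All-applyUpTo _ m (λ _ ())
           ∷ applyUpTo⁺₁ _ m (λ i<j _ eq → <⇒≢ i<j (+-cancelˡ-≡ k _ _ (suc-injective eq)))
  }

clique-set⁺ : ∀ k {m} (i : Fin m) → suc (k + toℕ i) ∈ₛ clique-set k m
clique-set⁺ k i = there (∈-applyUpTo⁺ _ (toℕ<n i))

clique-set⁻ : ∀ k m {v} → v ∈ₛ clique-set k m → v ≡ 0 ⊎ (k < v × v ≤ k + m)
clique-set⁻ k m (here v≡0) = inj₁ v≡0
clique-set⁻ k m (there v∈) with i , i<m , refl ← ∈-applyUpTo⁻ _ v∈ =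
  inj₂ (s≤s (m≤m+n k i) , ≤-trans (≤-reflexive (sym (+-suc k i))) (+-monoʳ-≤ k i<m))

boundary : FinSet
boundary = clique-set 0 0

clique : ℕ → ℕ → BoundariedGraph boundary
clique k m = record { graph = complete (clique-set k m) ; boundary⊆V = λ { (here refl) → here refl } }

module _ (G : BoundariedGraph boundary) where

  gluable-clique : ∀ k m → (∀ {v} → v ∈ₛ V (graph G) → v ≤ k) → Gluable G (clique k m)
  gluable-clique k m V≤k v∈G v∈H with clique-set⁻ k m v∈H
  ... | inj₁ refl      = here refl , here refl
  ... | inj₂ (k<v , _) = contradiction (V≤k v∈G) (<⇒≱ k<v)

  gluable-point : Gluable G (clique 0 0)
  gluable-point v∈G v∈H = v∈H , v∈H

  -- The bound does not depend on `m`. Since 0 is the only shared vertex, the two sides have no edge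
  -- in common and deleting all edges of `G` leaves the glued clique intact.
  gluing-clique≤∣V∣² : ∀ {k m} (p : Gluable G (clique k m)) →
    Σ[ s ∈ Solution ClusterEditing (G ⊕ clique k m [ p ]) ]
      solutionValue ClusterEditing (G ⊕ clique k m [ p ]) s ≤ ∣ V (graph G) ∣ₛ * ∣ V (graph G) ∣ₛ
  gluing-clique≤∣V∣² {k} {m} p = ∃solution≤∣V∣² G (clique k m) p (clique-set k m) refl disjoint
    where
    boundary≡0 : ∀ {v} → v ∈ₛ boundary → v ≡ 0
    boundary≡0 (here v≡0) = v≡0

    disjoint : ∀ u v → Adj (graph G) u v → ¬ Adj (graph (clique k m)) u v
    disjoint u v uv∈G uv∈H with u∈H , v∈H , u≢v ← adj-complete⁻ (clique-set k m) uv∈H =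
      u≢v (trans (shared u∈G u∈H) (sym (shared v∈G v∈H)))
      where
      u∈G = adj-inV (graph G) u v uv∈G
      v∈G = adj-inV (graph G) v u (trans (adj-sym (graph G) v u) uv∈G)
      shared : ∀ {w} → w ∈ₛ V (graph G) → w ∈ₛ clique-set k m → w ≡ 0
      shared w∈G w∈H = boundary≡0 (proj₁ (p w∈G w∈H))

clique⊕point : ∀ k m (p : Gluable (clique k m) (clique 0 0)) →
  Σ[ s ∈ Solution ClusterEditing (clique k m ⊕ clique 0 0 [ p ]) ]
    solutionValue ClusterEditing (clique k m ⊕ clique 0 0 [ p ]) s ≡ 0
clique⊕point k m p = (∅ₚ , isCluster-complete (clique-set k m) (clique k m ⊕ clique 0 0 [ p ] △ ∅ₚ) λ u v →
    trans (xor-identityʳ _) (no-edge u v)) , refl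
  where
  no-edge : ∀ u v → adj (complete (clique-set k m)) u v ∨ adj (complete boundary) u v
                  ≡ adj (complete (clique-set k m)) u v
  no-edge u v with adj (complete (clique-set k m)) u v | adj (complete boundary) u v in uv
  ... | true  | _     = refl
  ... | false | false = refl
  ... | false | true with adj-complete⁻ boundary {u} {v} uv
  ...   | here refl , here refl , 0≢0 = contradiction refl 0≢0

-- The paths run from the `i`-th private vertex of one clique through 0 to the `i`-th private vertex
-- of the other. The condition `m ≤ k` puts every name of the second kind above every name of the
-- first, as `paths≤solutionValue` requires.
clique⊕clique : ∀ {k} m → m ≤ k → (p : Gluable (clique 0 m) (clique k m)) →
  ∀ s → m ≤ solutionValue ClusterEditing (clique 0 m ⊕ clique k m [ p ]) s
clique⊕clique {k} m m≤k p = paths≤solutionValue (clique 0 m ⊕ clique k m [ p ]) a c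
  (λ _ → z<s) (λ i → a<c i i)
  (λ eq → toℕ-injective (suc-injective eq))
  (λ eq → toℕ-injective (+-cancelˡ-≡ k _ _ (suc-injective eq)))
  (λ i j → <⇒≢ (a<c i j))
  (λ i → cong (_∨ adj K 0 (a i)) (adj-complete⁺ (clique-set 0 m) (here refl) (a∈ i) λ ()))
  (λ i → ∨-true (adj K₀ 0 (c i)) (adj-complete⁺ (clique-set k m) (here refl) (c∈ i) λ ()))
  (λ i → [ (λ ac → c∉ i (proj₁ (proj₂ (adj-complete⁻ (clique-set 0 m) {u = a i} {v = c i} ac))))
         , (λ ac → a∉ i (proj₁ (adj-complete⁻ (clique-set k m) {u = a i} {v = c i} ac))) ]′
         ∘ ∨-true⁻ (adj K₀ (a i) (c i)))
  where
  K₀ = graph (clique 0 m)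
  K  = graph (clique k m)

  a c : Fin m → ℕ
  a i = suc (toℕ i)
  c i = suc (k + toℕ i)

  a<c : ∀ i j → a i < c j
  a<c i j = s<s (<-≤-trans (toℕ<n i) (≤-trans m≤k (m≤m+n k (toℕ j))))

  a∈ : ∀ i → a i ∈ₛ clique-set 0 m
  a∈ = clique-set⁺ 0

  c∈ : ∀ i → c i ∈ₛ clique-set k m
  c∈ = clique-set⁺ k

  a∉ : ∀ i → ¬ a i ∈ₛ clique-set k m
  a∉ i a∈H with proj₁ (p (a∈ i) a∈H)
  ... | here ()

  c∉ : ∀ i → ¬ c i ∈ₛ clique-set 0 m
  c∉ i c∈G with proj₁ (p c∈G (c∈ i))
  ... | here ()

  ∨-true : ∀ x {y} → y ≡ true → x ∨ y ≡ true
  ∨-true true  _  = refl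
  ∨-true false eq = eq

  ∨-true⁻ : ∀ x {y} → x ∨ y ≡ true → x ≡ true ⊎ y ≡ true
  ∨-true⁻ true  _  = inj₁ refl
  ∨-true⁻ false eq = inj₂ eq

-- Comparing two gluings and the contradiction

-- Two gluings eliminate the unknown shift `Δ`. Stating the result with sums avoids subtraction and
-- brings it back to natural numbers.
shift-difference : ∀ {k₀ k₀′ k₁ k₁′} Δ → + k₀ ≡ + k₀′ ℤ.+ Δ → + k₁ ≡ + k₁′ ℤ.+ Δ →
                   k₁ + k₀′ ≡ k₁′ + k₀
shift-difference {k₀} {k₀′} {k₁} {k₁′} Δ eq₀ eq₁ = ℤ.+-injective (begin
  + k₁ ℤ.+ + k₀′            ≡⟨ cong (ℤ._+ + k₀′) eq₁ ⟩
  + k₁′ ℤ.+ Δ ℤ.+ + k₀′     ≡⟨ rearrange (+ k₁′) Δ (+ k₀′) ⟩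
  + k₁′ ℤ.+ (+ k₀′ ℤ.+ Δ)   ≡⟨ cong (ℤ._+_ (+ k₁′)) eq₀ ⟨
  + k₁′ ℤ.+ + k₀            ∎)
  where
  open ≡-Reasoning
  rearrange : ∀ x y z → x ℤ.+ y ℤ.+ z ≡ x ℤ.+ (z ℤ.+ y)
  rearrange = solve-∀

-- The test graphs are the single boundary vertex (optima `k₀`, `k₀′`) and a large clique (optima
-- `k₁`, `k₁′`). Here `k₀` is 0 and `k₁` is at least `m`, while `k₁′` is bounded in terms of `G′`
-- alone.
equivalent-to-clique⇒m≤∣V∣² : ∀ m (G′ : BoundariedGraph boundary) →
  GluingEquivalent ClusterEditing (clique 0 m) G′ → m ≤ ∣ V (graph G′) ∣ₛ * ∣ V (graph G′) ∣ₛ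
equivalent-to-clique⇒m≤∣V∣² m G′ (Δ , shift) =
  let k₀ , k₀′ , (_ , k₀-min) , _ , eq₀ = shift (clique 0 0) G⊕point (gluable-point G′)
      k₁ , k₁′ , ((s₁ , s₁≡k₁) , _) , (_ , k₁′-min) , eq₁ = shift (clique K m) G⊕K G′⊕K
      s₀ , s₀≡0     = clique⊕point 0 m G⊕point
      s₁′ , s₁′≤∣V∣² = gluing-clique≤∣V∣² G′ {K} {m} G′⊕K
  in begin
  m                                       ≤⟨ clique⊕clique m m≤K G⊕K s₁ ⟩
  _                                       ≡⟨ s₁≡k₁ ⟩
  k₁                                      ≤⟨ m≤m+n k₁ k₀′ ⟩
  k₁ + k₀′                                ≡⟨ shift-difference Δ eq₀ eq₁ ⟩
  k₁′ + k₀                                ≤⟨ +-mono-≤ (≤-trans (k₁′-min s₁′) s₁′≤∣V∣²)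
                                                      (≤-trans (k₀-min s₀) (≤-reflexive s₀≡0)) ⟩
  ∣ V (graph G′) ∣ₛ * ∣ V (graph G′) ∣ₛ + 0 ≡⟨ +-identityʳ _ ⟩
  ∣ V (graph G′) ∣ₛ * ∣ V (graph G′) ∣ₛ   ∎
  where
  open ≤-Reasoning
  VG′ = elems (V (graph G′))
  -- The non-boundary names of the glued clique exceed all names used in G and G′.
  K   = m + max 0 VG′
  m≤K = m≤m+n m (max 0 VG′)
  G⊕point : Gluable (clique 0 m) (clique 0 0)
  G⊕point = gluable-point (clique 0 m)
  G⊕K : Gluable (clique 0 m) (clique K m)
  G⊕K = gluable-clique (clique 0 m) K m λ v∈G →
    [ (λ { refl → z≤n }) , (λ (_ , v≤m) → ≤-trans v≤m m≤K) ]′ (clique-set⁻ 0 m v∈G)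
  G′⊕K : Gluable G′ (clique K m)
  G′⊕K = gluable-clique G′ K m λ v∈G′ → ≤-trans (All.lookup (xs≤max 0 VG′) v∈G′) (m≤n+m _ m)

-- Asking only that cliques cost nothing under `ρ` treats cvd and ce at once.
no-boundaried-kernelization : ∀ ρ →
  (∀ S → Σ[ s ∈ Solution ρ (complete S) ] solutionValue ρ (complete S) s ≡ 0) →
  ¬ AdmitsBoundariedKernelization ClusterEditing ρ
no-boundaried-kernelization ρ free (f , _ , kernelization) =
  <⇒≱ (n<1+n N) (begin
    suc N                                   ≤⟨ equivalent-to-clique⇒m≤∣V∣² (suc N) G′ (Kernel.equivalent K) ⟩
    ∣ V (graph G′) ∣ₛ * ∣ V (graph G′) ∣ₛ   ≤⟨ ∣V∣²≤graphSize (graph G′) ⟩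
    graphSize (graph G′)                    ≤⟨ Kernel.graph-size K ⟩
    f (suc (solutionValue ρ _ s))           ≡⟨ cong (f ∘ suc) (proj₂ (free S)) ⟩
    N                                       ∎)
  where
  open ≤-Reasoning
  -- The boundary has one vertex and `s` has value 0, so the parameter is 1. Taking `suc N` private
  -- vertices in the clique then forces `suc N ≤ N`.
  N = f 1
  S = clique-set 0 (suc N)
  s = proj₁ (free S)
  K = proj₁ (BoundariedKernelization.correct kernelization (clique 0 (suc N)) s)
  G′ = Kernel.G′ K

mainTheorem10 : ¬ AdmitsBoundariedKernelization ClusterEditing ClusterVertexDeletion
    × ¬ AdmitsBoundariedKernelization ClusterEditing ClusterEditing
mainTheorem10 =
    no-boundaried-kernelization ClusterVertexDeletion complete-cvd
  , no-boundaried-kernelization ClusterEditing complete-ce
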